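{- Let $q$ be a prime power, let $f(X)=X^2+bX+c\in\mathbb F_q[X]$ be irreducible, and write $$\frac{X^{q+2}-cX}{f(X)}=h_1X^q+h_2X^{q-1}+\cdots+h_qX+h_{q+1}$$ (the quotient is a polynomial because $f(X)\mid X^{q+1}-c$). Let $\{U_i\}_{i\ge0}$ be the Lucas sequence of the first type associated to $f(X)$. Then $h_i=U_i$ for every $1\le i\le q+1$.
   Context: The Lucas sequence of the first type associated to $f(X)=X^2+bX+c$ is defined by $U_0=0$, $U_1=1$, and $U_n=-bU_{n-1}-cU_{n-2}$ for $n\ge2$ (elements of $\mathbb F_q$). -}

module Defs where

open import Algebra.Apartness.Bundles using (HeytingField; HeytingCommutativeRing)
open import Algebra.Bundles using (CommutativeRing)
open import Algebra.Bundles.Raw using (RawRing)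
import Algebra.Definitions.RawSemiring
open import Data.Fin.Base using (Fin; toℕ)
open import Data.List.Base using (List; []; _∷_; map)
import Data.Nat.Base as ℕ
open import Data.Nat.Base using (ℕ; zero; suc)
open import Data.Nat.Primality using (Prime)
open import Data.Product.Base using (∃₂; _×_)
open import Function.Bundles using (Bijection)
open import Level using (_⊔_)
open import Relation.Binary.PropositionalEquality.Core using (_≡_)
import Relation.Binary.PropositionalEquality.Properties as ≡

IsPrimePower : ℕ → Set
IsPrimePower q = ∃₂ λ p k → Prime p × 1 ℕ.≤ k × q ≡ p ℕ.^ k

-- The bijection makes _≈_ and invertibility decidable; with tightness _#_ is
-- then the negation of _≈_, so a Heyting field of cardinality q is the same
-- thing as a field with q elements in the usual sense.
HasCardinality : ∀ {a ℓ₁ ℓ₂} → HeytingField a ℓ₁ ℓ₂ → ℕ → Set (a ⊔ ℓ₁)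
HasCardinality F q = Bijection (≡.setoid (Fin q)) (HeytingField.setoid F)

ringOf : ∀ {a ℓ₁ ℓ₂} → HeytingField a ℓ₁ ℓ₂ → CommutativeRing a ℓ₁
ringOf F =
  HeytingCommutativeRing.commutativeRing (HeytingField.heytingCommutativeRing F)

module Lucas {a ℓ} (R : CommutativeRing a ℓ) where
  open CommutativeRing R

  U : (b c : Carrier) → ℕ → Carrier
  U b c zero          = 0#
  U b c (suc zero)    = 1#
  U b c (suc (suc n)) = (- b) * U b c (suc n) - c * U b c n

module Polynomial {a ℓ} (R : CommutativeRing a ℓ) where
  private module R = CommutativeRing R
  open R using (0#; 1#)

  infix  8 -ₚ_
  infixl 7 _*ₚ_
  infixl 6 _+ₚ_ _-ₚ_
  infix  4 _≈ₚ_

  -- Coefficients are listed from the constant term upwards.  Trailing zeros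
  -- are allowed; _≈ₚ_ ignores them.
  Poly : Set a
  Poly = List R.Carrier

  coeff : Poly → ℕ → R.Carrier
  coeff []      n       = 0#
  coeff (x ∷ p) zero    = x
  coeff (x ∷ p) (suc n) = coeff p n

  _≈ₚ_ : Poly → Poly → Set ℓ
  p ≈ₚ r = ∀ n → coeff p n R.≈ coeff r n

  _+ₚ_ : Poly → Poly → Poly
  []      +ₚ r       = r
  (x ∷ p) +ₚ []      = x ∷ p
  (x ∷ p) +ₚ (y ∷ r) = (x R.+ y) ∷ (p +ₚ r)

  -ₚ_ : Poly → Poly
  -ₚ p = map (λ x → R.- x) p

  _-ₚ_ : Poly → Poly → Poly
  p -ₚ r = p +ₚ (-ₚ r)

  -- (x + X p) r = x r + X (p r)
  _*ₚ_ : Poly → Poly → Poly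
  []      *ₚ r = []
  (x ∷ p) *ₚ r = map (x R.*_) r +ₚ (0# ∷ (p *ₚ r))

  C : R.Carrier → Poly
  C x = x ∷ []

  X : Poly
  X = 0# ∷ 1# ∷ []

  polyRawRing : RawRing a ℓ
  polyRawRing = record
    { Carrier = Poly
    ; _≈_     = _≈ₚ_
    ; _+_     = _+ₚ_
    ; _*_     = _*ₚ_
    ; -_      = -ₚ_
    ; 0#      = []
    ; 1#      = C 1#
    }

  open Algebra.Definitions.RawSemiring (RawRing.rawSemiring polyRawRing) public
    using (_^_; _∣_; Irreducible; sum)

  quadratic : (b c : R.Carrier) → Poly
  quadratic b c = X ^ 2 +ₚ C b *ₚ X +ₚ C c

  -- h 1 X^m + h 2 X^(m-1) + ⋯ + h m X + h (m+1); the values of h outside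
  -- 1, …, m+1 play no role.
  descending : ℕ → (ℕ → R.Carrier) → Poly
  descending m h =
    sum λ (j : Fin (suc m)) → C (h (suc (toℕ j))) *ₚ X ^ (m ℕ.∸ toℕ j)

  IsQuotient : ℕ → (b c : R.Carrier) → (ℕ → R.Carrier) → Set ℓ
  IsQuotient q b c h =
    descending q h *ₚ quadratic b c ≈ₚ X ^ (q ℕ.+ 2) -ₚ C c *ₚ X

-- Let x be a root of f in K = F_q[X]/(f).  Since xⁿ = Uₙ x − c Uₙ₋₁, the
-- divisibility f ∣ X^(q+1) − c amounts to U_q = −1 and U_(q+1) = 0, that is, to
-- x^q = −b − x being the conjugate root.  On K the identity
-- y^q − y = ∏ (y − a), a ∈ F_q, holds; replacing y by y + e with e ∈ F_q only
-- permutes the factors, so (y + e)^q = y^q + e.  Hence x^q is again a root of f,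
-- and as K has no zero divisors x^q is x or −b − x.  The first is impossible: it
-- would make ∏ (x − a) vanish.  As for the quotient, comparing coefficients in
-- h f = X^(q+2) − c X from the top down gives the Lucas recurrence for hᵢ.

module Submission where

open import Defs
open import Algebra.Bundles using (CommutativeRing; CommutativeMonoid; AbelianGroup)
open import Algebra.Apartness.Bundles using (HeytingField)
open import Data.Nat.Base as ℕ using (ℕ; zero; suc)
open import Data.Fin.Base using (Fin; zero; suc; punchIn)
open import Data.Fin.Properties using (suc-injective; any?; _≟_; punchInᵢ≢i)
import Data.Fin.Permutation as Perm
open import Data.List.Base using ([]; _∷_; map)
import Data.Nat.Properties as ℕ
open import Data.Vec.Base using (Vec; []; _∷_; replicate)
open import Data.Product.Base using (_×_; _,_; proj₁; proj₂; ∃)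
open import Data.Sum.Base using (_⊎_; inj₁; inj₂; [_,_]′)
open import Data.Empty using (⊥-elim)
open import Function.Base using (_∘_)
open import Function.Bundles using (Bijection)
open import Level using (_⊔_)
open import Relation.Nullary using (¬_; yes; no)
open import Relation.Nullary.Decidable using (map′)
open import Relation.Binary.Definitions using (Decidable)
open import Relation.Binary.PropositionalEquality.Core as ≡ using (_≡_; _≢_)
open import Algebra.Morphism.Structures using (IsRingMonomorphism)
open import Algebra.Bundles.Raw using (RawRing)
import Algebra.Definitions.RawMagma as RawMagmaDefinitions
import Algebra.Consequences.Setoid as Consequences
import Algebra.Definitions as AlgebraDefinitions
import Algebra.Construct.DirectProduct as DirectProduct
import Algebra.Properties.CommutativeMonoid.Sum as CMSum
import Algebra.Properties.CommutativeSemiring.Exp as Exp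
import Algebra.Properties.Group as GroupProperties
import Algebra.Properties.Ring as RingProperties
import Algebra.Solver.Ring.NaturalCoefficients.Default as Solver
import Relation.Binary.Reasoning.Setoid as SetoidReasoning

-- Additivity of the q-th power map is wanted only for `x * x ≈ β * x + γ`, where the summand `γ`
-- lies in F. The shift identity covers that case, and `β * x` is handled by multiplicativity
-- together with `β ^ q ≈ β`, so no binomial coefficients have to be reduced. The product formula
-- rests on two facts: every element of F is a root of y^q - y (`fermat`), and K is a domain. The
-- second is where irreducibility enters, in the form that the quadratic has no root in F. The
-- relation is kept in the form x² = β x + γ with `β = - b` and `γ = - c`, and a difference y - x is
-- replaced where possible by a variable `d` with `d + x ≈ y`. Without subtraction the identities
-- have natural coefficients, and a solver for commutative semirings settles them.

NoZeroDivisors : ∀ {a ℓ} → CommutativeRing a ℓ → Set (a ⊔ ℓ)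
NoZeroDivisors R = ∀ {x y} → x * y ≈ 0# → x ≈ 0# ⊎ y ≈ 0#
  where open CommutativeRing R

NoRoot : ∀ {a ℓ} (R : CommutativeRing a ℓ) (b c : CommutativeRing.Carrier R) → Set (a ⊔ ℓ)
NoRoot R b c = ∀ r → ¬ r * r ≈ - b * r - c
  where open CommutativeRing R

-- Monic polynomials with as many distinct roots as their degree.

-- A vector of length n stands for the monic polynomial of degree n whose
-- lower coefficients it lists, from the constant term upwards.
module MonicPolynomial {a ℓ} (R : CommutativeRing a ℓ) where
  open CommutativeRing R hiding (zero)
  open SetoidReasoning setoid
  open Solver commutativeSemiring using (solve; _:=_; _:+_; _:*_)
  open GroupProperties +-group using (x∙y⁻¹≈ε⇒x≈y)
  open CMSum *-commutativeMonoid using () renaming (sum to ∏)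
  open Exp commutativeSemiring using (_^_)

  ⟦_⟧ : ∀ {n} → Vec Carrier n → Carrier → Carrier
  ⟦ [] ⟧    y = 1#
  ⟦ e ∷ v ⟧ y = e + y * ⟦ v ⟧ y

  ⟦⟧-cong : ∀ {n} (v : Vec Carrier n) {x y} → x ≈ y → ⟦ v ⟧ x ≈ ⟦ v ⟧ y
  ⟦⟧-cong []      x≈y = refl
  ⟦⟧-cong (e ∷ v) x≈y = +-congˡ (*-cong x≈y (⟦⟧-cong v x≈y))

  ⟦replicate-0⟧ : ∀ n y → ⟦ replicate n 0# ⟧ y ≈ y ^ n
  ⟦replicate-0⟧ zero    y = refl
  ⟦replicate-0⟧ (suc n) y = trans (+-identityˡ _) (*-congˡ (⟦replicate-0⟧ n y))

  -- Synthetic division by y - r: the coefficients are the intermediate values of Horner's scheme at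
  -- `r`, and the remainder `⟦ v ⟧ r` is dropped.
  quotient : ∀ {n} → Carrier → Vec Carrier (suc n) → Vec Carrier n
  quotient r (e ∷ [])        = []
  quotient r (e ∷ v@(_ ∷ _)) = ⟦ v ⟧ r ∷ quotient r v

  -- Division with remainder at y = r + d. With `d` in place of y - r no subtraction occurs.
  ⟦⟧-shift : ∀ {n} (v : Vec Carrier (suc n)) r d →
             ⟦ v ⟧ (r + d) ≈ ⟦ v ⟧ r + d * ⟦ quotient r v ⟧ (r + d)
  ⟦⟧-shift (e ∷ []) r d =
    solve 4 (λ e r d i → e :+ (r :+ d) :* i := (e :+ r :* i) :+ d :* i) refl e r d 1#
  ⟦⟧-shift (e ∷ v@(_ ∷ _)) r d = begin
    e + (r + d) * ⟦ v ⟧ (r + d)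
      ≈⟨ +-congˡ (*-congˡ (⟦⟧-shift v r d)) ⟩
    e + (r + d) * (⟦ v ⟧ r + d * w)
      ≈⟨ solve 5 (λ e r d f w →
           e :+ (r :+ d) :* (f :+ d :* w) :=
           e :+ r :* f :+ d :* (f :+ (r :+ d) :* w)) refl e r d (⟦ v ⟧ r) w ⟩
    e + r * ⟦ v ⟧ r + d * (⟦ v ⟧ r + (r + d) * w) ∎
    where w = ⟦ quotient r v ⟧ (r + d)

  factor : ∀ {n} (v : Vec Carrier (suc n)) r → ⟦ v ⟧ r ≈ 0# →
           ∀ y → ⟦ v ⟧ y ≈ (y - r) * ⟦ quotient r v ⟧ y
  factor v r root y = begin
    ⟦ v ⟧ y                                            ≈⟨ ⟦⟧-cong v y≈r+d ⟩
    ⟦ v ⟧ (r + (y - r))                                ≈⟨ ⟦⟧-shift v r (y - r) ⟩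
    ⟦ v ⟧ r + (y - r) * ⟦ quotient r v ⟧ (r + (y - r)) ≈⟨ +-congʳ root ⟩
    0# + (y - r) * ⟦ quotient r v ⟧ (r + (y - r))      ≈⟨ +-identityˡ _ ⟩
    (y - r) * ⟦ quotient r v ⟧ (r + (y - r))
      ≈⟨ *-congˡ (⟦⟧-cong (quotient r v) y≈r+d) ⟨
    (y - r) * ⟦ quotient r v ⟧ y                       ∎
    where
    y≈r+d : y ≈ r + (y - r)
    y≈r+d = sym (begin
      r + (y - r)   ≈⟨ +-comm r (y - r) ⟩
      y - r + r     ≈⟨ +-assoc y (- r) r ⟩
      y + (- r + r) ≈⟨ +-congˡ (-‿inverseˡ r) ⟩
      y + 0#        ≈⟨ +-identityʳ y ⟩
      y             ∎)

  -- Splitting off the root `s zero` lowers the degree by one. Every other `s i` remains a root of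
  -- the quotient, because `s i - s zero` is nonzero by injectivity and there are no zero divisors.
  factorisation : NoZeroDivisors R →
                  ∀ {n} (v : Vec Carrier n) (s : Fin n → Carrier) →
                  (∀ {i j} → s i ≈ s j → i ≡ j) → (∀ i → ⟦ v ⟧ (s i) ≈ 0#) →
                  ∀ y → ⟦ v ⟧ y ≈ ∏ (λ i → y - s i)
  factorisation domain []        s inj root y = refl
  factorisation domain v@(_ ∷ _) s inj root y =
    trans (factor v (s zero) (root zero) y)
      (*-congˡ (factorisation domain (quotient (s zero) v) (s ∘ suc)
                 (suc-injective ∘ inj) root′ y))
    where
    root′ : ∀ i → ⟦ quotient (s zero) v ⟧ (s (suc i)) ≈ 0#
    root′ i with domain (trans (sym (factor v (s zero) (root zero) (s (suc i)))) (root (suc i)))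
    ... | inj₂ eq = eq
    ... | inj₁ eq with () ← inj (x∙y⁻¹≈ε⇒x≈y (s (suc i)) (s zero) eq)

-- Adjoining a root of a quadratic.

module QuadraticExtension {a ℓ} (R : CommutativeRing a ℓ)
  (β γ : CommutativeRing.Carrier R) where
  open CommutativeRing R hiding (zero)
  open Solver commutativeSemiring using (solve; _:=_; _:+_; _:*_; con)

  -- (u , v) is u + v x, where x² = β x + γ
  infixl 7 _⊛_
  _⊛_ : Carrier × Carrier → Carrier × Carrier → Carrier × Carrier
  (u , v) ⊛ (u′ , v′) = u * u′ + γ * (v * v′) , u * v′ + v * u′ + β * (v * v′)

  private
    module + = AbelianGroup (DirectProduct.abelianGroup +-abelianGroup +-abelianGroup)
    open AlgebraDefinitions +._≈_
    open Consequences +.setoid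

  ⊛-cong : Congruent₂ _⊛_
  ⊛-cong (p , q) (p′ , q′) =
    +-cong (*-cong p p′) (*-congˡ (*-cong q q′)) ,
    +-cong (+-cong (*-cong p q′) (*-cong q p′)) (*-congˡ (*-cong q q′))

  -- A polynomial identity in which `β` and `γ` are indeterminates; no property of the quadratic is
  -- involved until zero divisors are excluded.
  ⊛-assoc : Associative _⊛_
  ⊛-assoc (u , v) (u′ , v′) (u″ , v″) =
    solve 8 (λ β γ u v u′ v′ u″ v″ →
      (u :* u′ :+ γ :* (v :* v′)) :* u″
        :+ γ :* ((u :* v′ :+ v :* u′ :+ β :* (v :* v′)) :* v″) :=
      u :* (u′ :* u″ :+ γ :* (v′ :* v″))
        :+ γ :* (v :* (u′ :* v″ :+ v′ :* u″ :+ β :* (v′ :* v″))))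
      refl β γ u v u′ v′ u″ v″ ,
    solve 8 (λ β γ u v u′ v′ u″ v″ →
      (u :* u′ :+ γ :* (v :* v′)) :* v″
        :+ (u :* v′ :+ v :* u′ :+ β :* (v :* v′)) :* u″
        :+ β :* ((u :* v′ :+ v :* u′ :+ β :* (v :* v′)) :* v″) :=
      u :* (u′ :* v″ :+ v′ :* u″ :+ β :* (v′ :* v″))
        :+ v :* (u′ :* u″ :+ γ :* (v′ :* v″))
        :+ β :* (v :* (u′ :* v″ :+ v′ :* u″ :+ β :* (v′ :* v″))))
      refl β γ u v u′ v′ u″ v″

  ⊛-comm : Commutative _⊛_
  ⊛-comm (u , v) (u′ , v′) =
    solve 5 (λ γ u v u′ v′ → u :* u′ :+ γ :* (v :* v′) := u′ :* u :+ γ :* (v′ :* v))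
      refl γ u v u′ v′ ,
    solve 5 (λ β u v u′ v′ →
      u :* v′ :+ v :* u′ :+ β :* (v :* v′) := u′ :* v :+ v′ :* u :+ β :* (v′ :* v))
      refl β u v u′ v′

  ⊛-identityˡ : LeftIdentity (1# , 0#) _⊛_
  ⊛-identityˡ (u , v) =
    solve 3 (λ γ u v → con 1 :* u :+ γ :* (con 0 :* v) := u) refl γ u v ,
    solve 3 (λ β u v → con 1 :* v :+ con 0 :* u :+ β :* (con 0 :* v) := v) refl β u v

  ⊛-distribˡ : _⊛_ DistributesOverˡ +._∙_
  ⊛-distribˡ (u , v) (u′ , v′) (u″ , v″) =
    solve 7 (λ γ u v u′ v′ u″ v″ →
      u :* (u′ :+ u″) :+ γ :* (v :* (v′ :+ v″)) :=
      (u :* u′ :+ γ :* (v :* v′)) :+ (u :* u″ :+ γ :* (v :* v″)))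
      refl γ u v u′ v′ u″ v″ ,
    solve 7 (λ β u v u′ v′ u″ v″ →
      u :* (v′ :+ v″) :+ v :* (u′ :+ u″) :+ β :* (v :* (v′ :+ v″)) :=
      (u :* v′ :+ v :* u′ :+ β :* (v :* v′)) :+ (u :* v″ :+ v :* u″ :+ β :* (v :* v″)))
      refl β u v u′ v′ u″ v″

  extension : CommutativeRing a ℓ
  extension = record
    { _*_ = _⊛_
    ; 1#  = 1# , 0#
    ; isCommutativeRing = record
      { isRing = record
        { +-isAbelianGroup = +.isAbelianGroup
        ; *-cong           = ⊛-cong
        ; *-assoc          = ⊛-assoc
        ; *-identity       = comm∧idˡ⇒id ⊛-comm ⊛-identityˡ
        ; distrib          = comm∧distrˡ⇒distr +.∙-cong ⊛-comm ⊛-distribˡ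
        }
      ; *-comm = ⊛-comm
      }
    }

-- Subtracting the two equations removes γ and leaves y² - x² = β (y - x).
quadratic-roots : ∀ {a ℓ} (R : CommutativeRing a ℓ) → let open CommutativeRing R in
  ∀ {x y β γ} → y * y ≈ β * y + γ → x * x ≈ β * x + γ → (y - x) * (y + x - β) ≈ 0#
quadratic-roots R {x} {y} {β} {γ} y² x² = begin
  (y - x) * (y + x - β)                  ≈⟨ distribˡ (y - x) (y + x) (- β) ⟩
  (y - x) * (y + x) + (y - x) * - β      ≈⟨ +-cong difference (sym (-‿distribʳ-* (y - x) β)) ⟩
  β * (y - x) - (y - x) * β              ≈⟨ +-congʳ (*-comm β (y - x)) ⟩
  (y - x) * β - (y - x) * β              ≈⟨ -‿inverseʳ _ ⟩
  0#                                     ∎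
  where
  open CommutativeRing R
  open SetoidReasoning setoid
  open GroupProperties +-group using (∙-cancelʳ; //-rightDividesˡ)
  open RingProperties ring using (-‿distribʳ-*)
  open Solver commutativeSemiring using (solve; _:=_; _:+_; _:*_)
  d = y - x
  d+x≈y : d + x ≈ y
  d+x≈y = //-rightDividesˡ x y
  difference : d * (y + x) ≈ β * d
  -- Adding `x * x` to both sides turns the claim into a chain that uses only `d + x ≈ y` and the
  -- two equations.
  difference = ∙-cancelʳ (x * x) _ _ (begin
    d * (y + x) + x * x   ≈⟨ solve 3 (λ d x y → d :* (y :+ x) :+ x :* x := d :* y :+ (d :+ x) :* x) refl d x y ⟩
    d * y + (d + x) * x   ≈⟨ +-congˡ (*-congʳ d+x≈y) ⟩
    d * y + y * x         ≈⟨ solve 3 (λ d x y → d :* y :+ y :* x := (d :+ x) :* y) refl d x y ⟩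
    (d + x) * y           ≈⟨ *-congʳ d+x≈y ⟩
    y * y                 ≈⟨ y² ⟩
    β * y + γ             ≈⟨ +-congʳ (*-congˡ d+x≈y) ⟨
    β * (d + x) + γ       ≈⟨ solve 4 (λ β γ d x → β :* (d :+ x) :+ γ := β :* d :+ (β :* x :+ γ)) refl β γ d x ⟩
    β * d + (β * x + γ)   ≈⟨ +-congˡ x² ⟨
    β * d + x * x         ∎)

-- The closure of nonzero elements under products is a hypothesis, so that the lemma serves both F,
-- where it comes from cancellation, and the extension, where it comes from `NoZeroDivisors`.
∏-≉0 : ∀ {a ℓ} (R : CommutativeRing a ℓ) → let open CommutativeRing R in
  ¬ 1# ≈ 0# → (∀ {x y} → ¬ x ≈ 0# → ¬ y ≈ 0# → ¬ x * y ≈ 0#) →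
  ∀ {n} (f : Fin n → Carrier) → (∀ i → ¬ f i ≈ 0#) → ¬ CMSum.sum *-commutativeMonoid f ≈ 0#
∏-≉0 R 1≉0 *-≉0 {zero}  f f≉0 = 1≉0
∏-≉0 R 1≉0 *-≉0 {suc n} f f≉0 = *-≉0 (f≉0 zero) (∏-≉0 R 1≉0 *-≉0 (f ∘ suc) (f≉0 ∘ suc))

-- Finite fields: inverses, reindexing of products, Fermat's little theorem.

module FiniteField {a ℓ₁ ℓ₂} (F : HeytingField a ℓ₁ ℓ₂) {q : ℕ}
  (card : HasCardinality F q) where
  open CommutativeRing (ringOf F) hiding (zero)
  open SetoidReasoning setoid
  open RingProperties ring using (-0#≈0#)
  open Exp commutativeSemiring using (_^_)
  private
    module F = HeytingField F
    module card = Bijection card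
    module Π = CMSum *-commutativeMonoid
  open Π using () renaming (sum to ∏)

  element : Fin q → Carrier
  element = card.to

  index : Carrier → Fin q
  index x = proj₁ (card.surjective x)

  element-index : ∀ x → element (index x) ≈ x
  element-index x = proj₂ (card.surjective x) ≡.refl

  element-injective : ∀ {i j} → element i ≈ element j → i ≡ j
  element-injective = card.injective

  index-injective : ∀ {x y} → index x ≡ index y → x ≈ y
  index-injective {x} {y} eq =
    trans (sym (element-index x)) (trans (card.cong eq) (element-index y))

  infix 4 _≈?_
  _≈?_ : Decidable _≈_
  x ≈? y = map′ index-injective
    (λ x≈y → card.injective (trans (element-index x) (trans x≈y (sym (element-index y)))))
    (index x ≟ index y)

  -- The difference 1 - 0 is invertible, hence 1 is apart from 0, and tightness turns this into
  -- inequality.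
  1≉0 : ¬ 1# ≈ 0#
  1≉0 1≈0 = proj₂ (F.tight 1# 0#) 1≈0
    (F.invertible⇒# (1# , 1*[1-0]≈1 , trans (*-comm _ _) 1*[1-0]≈1))
    where
    1*[1-0]≈1 : 1# * (1# - 0#) ≈ 1#
    1*[1-0]≈1 = trans (*-identityˡ _) (trans (+-congˡ -0#≈0#) (+-identityʳ 1#))

  -- Finiteness allows a search through all elements. If it fails, `x` cannot be apart from 0, since
  -- apartness would supply an inverse; tightness then gives `x ≈ 0#`.
  inverse : ∀ {x} → ¬ x ≈ 0# → ∃ λ y → y * x ≈ 1#
  inverse {x} x≉0 with any? (λ i → element i * x ≈? 1#)
  ... | yes (i , eq) = element i , eq
  ... | no ¬inv = ⊥-elim (x≉0 (proj₁ (F.tight x 0#) λ x#0 →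
    let y , y*[x-0]≈1 , _ = F.#⇒invertible x#0 in
    ¬inv (index y , (begin
      element (index y) * x ≈⟨ *-congʳ (element-index y) ⟩
      y * x                 ≈⟨ *-congˡ (trans (+-congˡ -0#≈0#) (+-identityʳ x)) ⟨
      y * (x - 0#)          ≈⟨ y*[x-0]≈1 ⟩
      1#                    ∎))))

  *-cancelˡ-≉0 : ∀ {x} y z → ¬ x ≈ 0# → x * y ≈ x * z → y ≈ z
  *-cancelˡ-≉0 {x} y z x≉0 eq with x⁻¹ , x⁻¹*x≈1 ← inverse x≉0 = begin
    y             ≈⟨ *-identityˡ y ⟨
    1# * y        ≈⟨ *-congʳ x⁻¹*x≈1 ⟨
    x⁻¹ * x * y   ≈⟨ *-assoc x⁻¹ x y ⟩
    x⁻¹ * (x * y) ≈⟨ *-congˡ eq ⟩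
    x⁻¹ * (x * z) ≈⟨ *-assoc x⁻¹ x z ⟨
    x⁻¹ * x * z   ≈⟨ *-congʳ x⁻¹*x≈1 ⟩
    1# * z        ≈⟨ *-identityˡ z ⟩
    z             ∎

  *-≉0 : ∀ {x y} → ¬ x ≈ 0# → ¬ y ≈ 0# → ¬ x * y ≈ 0#
  *-≉0 x≉0 y≉0 xy≈0 = y≉0 (*-cancelˡ-≉0 _ _ x≉0 (trans xy≈0 (sym (zeroʳ _))))

  -- Carried through the enumeration, `σ` and `τ` become a permutation of `Fin q`. The monoid is
  -- arbitrary because the products live in F for `fermat` and in the extension for `[y+e]^q`.
  ∏-reindex : ∀ {b ℓ} (M : CommutativeMonoid b ℓ) →
    let module M = CommutativeMonoid M in
    (σ τ : Carrier → Carrier) → (∀ {x y} → x ≈ y → σ x ≈ σ y) → (∀ {x y} → x ≈ y → τ x ≈ τ y) →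
    (∀ x → σ (τ x) ≈ x) → (∀ x → τ (σ x) ≈ x) →
    (f : Carrier → M.Carrier) → (∀ {x y} → x ≈ y → f x M.≈ f y) →
    CMSum.sum M (f ∘ element) M.≈ CMSum.sum M (f ∘ σ ∘ element)
  ∏-reindex M σ τ σ-cong τ-cong στ τσ f f-cong =
    M.trans (CMSum.sum-permute M (f ∘ element) π)
      (CMSum.sum-cong-≋ M {q} λ i → f-cong (element-index (σ (element i))))
    where
    module M = CommutativeMonoid M
    section : (ρ θ : Carrier → Carrier) → (∀ {x y} → x ≈ y → ρ x ≈ ρ y) →
              (∀ x → ρ (θ x) ≈ x) → ∀ i → index (ρ (element (index (θ (element i))))) ≡ i
    section ρ θ ρ-cong ρθ i = element-injective
      (trans (element-index _) (trans (ρ-cong (element-index _)) (ρθ (element i))))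
    π : Perm.Permutation q q
    π = Perm.permutation (index ∘ σ ∘ element) (index ∘ τ ∘ element)
          (section σ τ σ-cong στ) (section τ σ τ-cong τσ)

  ∏-single : ∀ {n} (f : Fin n → Carrier) i → (∀ j → j ≢ i → f j ≈ 1#) → ∏ f ≈ f i
  ∏-single {suc n} f i f≈1 = begin
    ∏ f                                ≈⟨ Π.sum-remove f ⟩
    f i * ∏ (λ j → f (punchIn i j))    ≈⟨ *-congˡ (Π.sum-cong-≋ (λ j → f≈1 _ (punchInᵢ≢i i j))) ⟩
    f i * ∏ {n} (λ _ → 1#)             ≈⟨ *-congˡ (Π.sum-replicate-zero n) ⟩
    f i * 1#                           ≈⟨ *-identityʳ (f i) ⟩
    f i                                ∎

  -- With g replacing 0 by 1, the products over y of g(y) x and of g(x y) differ by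
  -- exactly one factor x, the one at y = 0.
  fermat : ∀ x → x ^ q ≈ x
  fermat x with x ≈? 0#
  -- A power of 0 is 0 only for a positive exponent; `index 0#` inhabits `Fin q` and so excludes the
  -- exponent 0.
  ... | yes x≈0 = 0^q (index 0#)
    where
    0^q : ∀ {n} → Fin n → x ^ n ≈ x
    0^q {suc n} _ = trans (*-congʳ x≈0) (trans (zeroˡ _) (sym x≈0))
  -- With 1 in place of 0 the product over all of F is nonzero and can be cancelled.
  ... | no x≉0 = *-cancelˡ-≉0 _ _ (∏-≉0 (ringOf F) 1≉0 *-≉0 (g ∘ element) (g≉0 ∘ element)) (begin
    ∏ (g ∘ element) * x ^ q
      ≈⟨ *-congˡ (Π.sum-replicate q) ⟨
    ∏ (g ∘ element) * ∏ {q} (λ _ → x)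
      ≈⟨ Π.∑-distrib-+ (g ∘ element) (λ _ → x) ⟨
    ∏ (λ i → g (element i) * x)
      ≈⟨ Π.sum-cong-≋ (λ i → g-scale (element i)) ⟩
    ∏ (λ i → g (x * element i) * k (element i))
      ≈⟨ Π.∑-distrib-+ (λ i → g (x * element i)) (k ∘ element) ⟩
    ∏ (λ i → g (x * element i)) * ∏ (k ∘ element)
      ≈⟨ *-cong (sym reindexed) ∏k≈x ⟩
    ∏ (g ∘ element) * x ∎)
    where
    g : Carrier → Carrier
    g y with y ≈? 0#
    ... | yes _ = 1#
    ... | no  _ = y

    k : Carrier → Carrier
    k y with y ≈? 0#
    ... | yes _ = x
    ... | no  _ = 1#

    g≉0 : ∀ y → ¬ g y ≈ 0#
    g≉0 y with y ≈? 0#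
    ... | yes _  = 1≉0
    ... | no y≉0 = y≉0

    g-cong : ∀ {y z} → y ≈ z → g y ≈ g z
    g-cong {y} {z} y≈z with y ≈? 0# | z ≈? 0#
    ... | yes _   | yes _   = refl
    ... | no  _   | no  _   = y≈z
    ... | yes y≈0 | no  z≉0 = ⊥-elim (z≉0 (trans (sym y≈z) y≈0))
    ... | no  y≉0 | yes z≈0 = ⊥-elim (y≉0 (trans y≈z z≈0))

    g-scale : ∀ y → g y * x ≈ g (x * y) * k y
    g-scale y with y ≈? 0# | x * y ≈? 0#
    ... | yes _   | yes _    = refl
    ... | no  _   | no  _    = trans (*-comm y x) (sym (*-identityʳ _))
    ... | yes y≈0 | no  xy≉0 = ⊥-elim (xy≉0 (trans (*-congˡ y≈0) (zeroʳ x)))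
    ... | no  y≉0 | yes xy≈0 = ⊥-elim (*-≉0 x≉0 y≉0 xy≈0)

    k-0 : ∀ y → y ≈ 0# → k y ≈ x
    k-0 y y≈0 with y ≈? 0#
    ... | yes _  = refl
    ... | no y≉0 = ⊥-elim (y≉0 y≈0)

    k-≉0 : ∀ y → ¬ y ≈ 0# → k y ≈ 1#
    k-≉0 y y≉0 with y ≈? 0#
    ... | yes y≈0 = ⊥-elim (y≉0 y≈0)
    ... | no  _   = refl

    ∏k≈x : ∏ (k ∘ element) ≈ x
    ∏k≈x = trans
      (∏-single (k ∘ element) (index 0#) λ j j≢0 → k-≉0 _ λ j≈0 →
        j≢0 (element-injective (trans j≈0 (sym (element-index 0#)))))
      (k-0 _ (element-index 0#))

    x⁻¹ : Carrier
    x⁻¹ = proj₁ (inverse x≉0)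

    reindexed : ∏ (g ∘ element) ≈ ∏ (λ i → g (x * element i))
    reindexed = ∏-reindex *-commutativeMonoid (x *_) (x⁻¹ *_) *-congˡ *-congˡ
      (λ y → trans (sym (*-assoc x x⁻¹ y)) (trans (*-congʳ (trans (*-comm x x⁻¹) (proj₂ (inverse x≉0)))) (*-identityˡ y)))
      (λ y → trans (sym (*-assoc x⁻¹ x y)) (trans (*-congʳ (proj₂ (inverse x≉0))) (*-identityˡ y)))
      g g-cong

-- The q-th power map on a domain containing F.

module ExtensionField {a ℓ₁ ℓ₂ b ℓ} (F : HeytingField a ℓ₁ ℓ₂) {m : ℕ}
  (card : HasCardinality F (2 ℕ.+ m)) (K : CommutativeRing b ℓ) (domain : NoZeroDivisors K)
  (ι : HeytingField.Carrier F → CommutativeRing.Carrier K)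
  (ι-mono : IsRingMonomorphism (CommutativeRing.rawRing (ringOf F)) (CommutativeRing.rawRing K) ι)
  where
  open CommutativeRing K hiding (zero)
  open SetoidReasoning setoid
  open GroupProperties +-group
    using (x≈y⇒x∙y⁻¹≈ε; x∙y⁻¹≈ε⇒x≈y; //-rightDividesˡ; //-rightDividesʳ; ⁻¹-anti-homo-∙)
  open RingProperties ring using (-‿distribʳ-*)
  open Exp commutativeSemiring using (_^_; ^-congˡ; ^-distrib-*)
  open MonicPolynomial K
  open FiniteField F card using (element; element-injective; fermat; ∏-reindex; 1≉0)
  private
    module F = CommutativeRing (ringOf F)
    module FG = GroupProperties F.+-group
    module FE = Exp F.commutativeSemiring
    module ι = IsRingMonomorphism ι-mono
    module Π = CMSum *-commutativeMonoid
    q = 2 ℕ.+ m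
  open Π using () renaming (sum to ∏)

  ι-^ : ∀ e n → ι e ^ n ≈ ι (e FE.^ n)
  ι-^ e zero    = sym ι.1#-homo
  ι-^ e (suc n) = trans (*-congˡ (ι-^ e n)) (sym (ι.*-homo e (e FE.^ n)))

  ι-fermat : ∀ e → ι e ^ q ≈ ι e
  ι-fermat e = trans (ι-^ e q) (ι.⟦⟧-cong (fermat e))

  -- The coefficients 0 and -1 must occupy two separate places below the leading one, hence the form
  -- 2 + m for q.
  X^q-X : Vec Carrier q
  X^q-X = 0# ∷ - 1# ∷ replicate m 0#

  ⟦X^q-X⟧ : ∀ y → ⟦ X^q-X ⟧ y ≈ y ^ q - y
  ⟦X^q-X⟧ y = begin
    0# + y * (- 1# + y * ⟦ replicate m 0# ⟧ y) ≈⟨ +-identityˡ _ ⟩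
    y * (- 1# + y * ⟦ replicate m 0# ⟧ y)
      ≈⟨ *-congˡ (+-congˡ (*-congˡ (⟦replicate-0⟧ m y))) ⟩
    y * (- 1# + y * y ^ m)                     ≈⟨ distribˡ y (- 1#) (y * y ^ m) ⟩
    y * - 1# + y ^ q                           ≈⟨ +-congʳ (-‿distribʳ-* y 1#) ⟨
    - (y * 1#) + y ^ q                         ≈⟨ +-congʳ (-‿cong (*-identityʳ y)) ⟩
    - y + y ^ q                                ≈⟨ +-comm (- y) (y ^ q) ⟩
    y ^ q - y                                  ∎

  -- By Fermat, and because `ι` is injective, the elements of F give q distinct roots of a monic
  -- polynomial of degree q.
  y^q-y≈∏ : ∀ y → y ^ q - y ≈ ∏ (λ i → y - ι (element i))
  y^q-y≈∏ y = trans (sym (⟦X^q-X⟧ y))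
    (factorisation domain X^q-X (ι ∘ element) (element-injective ∘ ι.injective) root y)
    where
    root : ∀ i → ⟦ X^q-X ⟧ (ι (element i)) ≈ 0#
    root i = trans (⟦X^q-X⟧ _) (x≈y⇒x∙y⁻¹≈ε (ι-fermat (element i)))

  [y+e]^q : ∀ y e → (y + ι e) ^ q ≈ y ^ q + ι e
  [y+e]^q y e = begin
    z ^ q                     ≈⟨ //-rightDividesˡ z (z ^ q) ⟨
    z ^ q - z + z             ≈⟨ +-congʳ shifted ⟩
    y ^ q - y + (y + ι e)     ≈⟨ +-assoc (y ^ q - y) y (ι e) ⟨
    y ^ q - y + y + ι e       ≈⟨ +-congʳ (//-rightDividesˡ y (y ^ q)) ⟩
    y ^ q + ι e               ∎
    where
    z = y + ι e
    difference : ∀ d → z - ι (d F.+ e) ≈ y - ι d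
    difference d = begin
      z - ι (d F.+ e)        ≈⟨ +-congˡ (-‿cong (ι.+-homo d e)) ⟩
      z - (ι d + ι e)        ≈⟨ +-congˡ (⁻¹-anti-homo-∙ (ι d) (ι e)) ⟩
      z + (- ι e - ι d)      ≈⟨ +-assoc z (- ι e) (- ι d) ⟨
      y + ι e - ι e - ι d    ≈⟨ +-congʳ (//-rightDividesʳ (ι e) y) ⟩
      y - ι d                ∎
    shifted : z ^ q - z ≈ y ^ q - y
    shifted = begin
      z ^ q - z                             ≈⟨ y^q-y≈∏ z ⟩
      ∏ (λ i → z - ι (element i))
        ≈⟨ ∏-reindex *-commutativeMonoid (F._+ e) (F._- e) F.+-congʳ F.+-congʳ
             (FG.//-rightDividesˡ e) (FG.//-rightDividesʳ e)
             (λ d → z - ι d) (λ d≈d′ → +-congˡ (-‿cong (ι.⟦⟧-cong d≈d′))) ⟩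
      ∏ (λ i → z - ι (element i F.+ e))
        ≈⟨ Π.sum-cong-≋ {q} (λ i → difference (element i)) ⟩
      ∏ (λ i → y - ι (element i))           ≈⟨ y^q-y≈∏ y ⟨
      y ^ q - y                             ∎

  ∏[x-a]≉0 : ∀ {x} → (∀ e → ¬ x ≈ ι e) → ¬ ∏ (λ i → x - ι (element i)) ≈ 0#
  ∏[x-a]≉0 {x} x∉F = ∏-≉0 K
    (λ 1≈0 → 1≉0 (ι.injective (trans ι.1#-homo (trans 1≈0 (sym ι.0#-homo)))))
    (λ y≉0 z≉0 → [ y≉0 , z≉0 ]′ ∘ domain)
    (λ i → x - ι (element i)) (λ i → x∉F (element i) ∘ x∙y⁻¹≈ε⇒x≈y x (ι (element i)))

  x^q+x≈β : ∀ {x β γ} → x * x ≈ ι β * x + ι γ → (∀ e → ¬ x ≈ ι e) → x ^ q + x ≈ ι β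
  x^q+x≈β {x} {β} {γ} x² x∉F =
    [ (λ x^q-x≈0 → ⊥-elim (x^q-x≉0 x^q-x≈0)) , x∙y⁻¹≈ε⇒x≈y (x ^ q + x) (ι β) ]′
      (domain (quadratic-roots K [x^q]² x²))
    where
    [x^q]² : x ^ q * x ^ q ≈ ι β * x ^ q + ι γ
    [x^q]² = begin
      x ^ q * x ^ q             ≈⟨ ^-distrib-* x x q ⟨
      (x * x) ^ q               ≈⟨ ^-congˡ q x² ⟩
      -- The shift identity detaches only `ι γ`; the other term is a product, and its factor `ι β`
      -- is fixed by Fermat.
      (ι β * x + ι γ) ^ q       ≈⟨ [y+e]^q (ι β * x) γ ⟩
      (ι β * x) ^ q + ι γ       ≈⟨ +-congʳ (^-distrib-* (ι β) x q) ⟩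
      ι β ^ q * x ^ q + ι γ     ≈⟨ +-congʳ (*-congʳ (ι-fermat β)) ⟩
      ι β * x ^ q + ι γ         ∎
    x^q-x≉0 : ¬ x ^ q - x ≈ 0#
    x^q-x≉0 x^q-x≈0 = ∏[x-a]≉0 x∉F (trans (sym (y^q-y≈∏ x)) x^q-x≈0)

-- Lucas numbers as coordinates of the powers of the adjoined root.

module LucasPeriod {a ℓ₁ ℓ₂} (F : HeytingField a ℓ₁ ℓ₂) {m : ℕ}
  (card : HasCardinality F (2 ℕ.+ m)) (b c : HeytingField.Carrier F)
  (no-root : NoRoot (ringOf F) b c)
  where
  open CommutativeRing (ringOf F) hiding (zero)
  open Lucas (ringOf F)
  open FiniteField F card
  open QuadraticExtension (ringOf F) (- b) (- c)
  open GroupProperties +-group using (inverseʳ-unique; inverseˡ-unique; ε⁻¹≈ε)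
  open RingProperties ring using (-‿distribˡ-*)
  private
    module K = CommutativeRing extension
    module KE = Exp K.commutativeSemiring
    q = 2 ℕ.+ m
    β = - b
    γ = - c

  -- The hypotheses say that multiplication by x maps u + v x to r (u + v x).
  eigenvector≈0 : ∀ r u v → γ * v ≈ r * u → u + β * v ≈ r * v → u ≈ 0# × v ≈ 0#
  eigenvector≈0 r u v γv≈ru u+βv≈rv with v ≈? 0#
  ... | yes v≈0 = (begin
    u          ≈⟨ +-identityʳ u ⟨
    u + 0#     ≈⟨ +-congˡ (trans (*-congˡ v≈0) (zeroʳ β)) ⟨
    u + β * v  ≈⟨ u+βv≈rv ⟩
    r * v      ≈⟨ *-congˡ v≈0 ⟩
    r * 0#     ≈⟨ zeroʳ r ⟩
    0#         ∎) , v≈0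
    where open SetoidReasoning setoid
  -- Eliminating `u` from the two equations gives v r² = v (β r + γ), and cancelling `v` would make
  -- `r` a root of the quadratic.
  ... | no v≉0 = ⊥-elim (no-root r (*-cancelˡ-≉0 _ _ v≉0 (begin
    v * (r * r)           ≈⟨ solve 2 (λ r v → v :* (r :* r) := r :* (r :* v)) refl r v ⟩
    r * (r * v)           ≈⟨ *-congˡ u+βv≈rv ⟨
    r * (u + β * v)       ≈⟨ distribˡ r u (β * v) ⟩
    r * u + r * (β * v)   ≈⟨ +-congʳ γv≈ru ⟨
    γ * v + r * (β * v)
      ≈⟨ solve 4 (λ β γ r v → γ :* v :+ r :* (β :* v) := v :* (β :* r :+ γ)) refl β γ r v ⟩
    v * (β * r + γ)       ∎)))
    where
    open SetoidReasoning setoid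
    open Solver commutativeSemiring using (solve; _:=_; _:+_; _:*_)

  -- If `t` is nonzero, dividing (s + t x)(u + v x) = 0 by `t` shows that multiplication by x acts
  -- on u + v x as the scalar -s/t, so `eigenvector≈0` applies. If `t` vanishes, the first factor is
  -- the scalar `s`, which is zero or can be cancelled.
  domain : NoZeroDivisors extension
  domain {s , t} {u , v} (e₁ , e₂) with t ≈? 0# | s ≈? 0#
  ... | yes t≈0 | yes s≈0 = inj₁ (s≈0 , t≈0)
  ... | yes t≈0 | no  s≉0 = inj₂
    ( *-cancelˡ-≉0 u 0# s≉0 (begin
        s * u                ≈⟨ solve 4 (λ γ s u v → s :* u := s :* u :+ γ :* (con 0 :* v)) refl γ s u v ⟩
        s * u + γ * (0# * v) ≈⟨ +-congˡ (*-congˡ (*-congʳ t≈0)) ⟨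
        s * u + γ * (t * v)  ≈⟨ e₁ ⟩
        0#                   ≈⟨ zeroʳ s ⟨
        s * 0#               ∎)
    , *-cancelˡ-≉0 v 0# s≉0 (begin
        s * v
          ≈⟨ solve 4 (λ β s u v → s :* v := s :* v :+ con 0 :* u :+ β :* (con 0 :* v)) refl β s u v ⟩
        s * v + 0# * u + β * (0# * v)
          ≈⟨ +-cong (+-congˡ (*-congʳ t≈0)) (*-congˡ (*-congʳ t≈0)) ⟨
        s * v + t * u + β * (t * v)
          ≈⟨ e₂ ⟩
        0#                   ≈⟨ zeroʳ s ⟨
        s * 0#               ∎))
    where
    open SetoidReasoning setoid
    open Solver commutativeSemiring using (solve; _:=_; _:+_; _:*_; con)
  ... | no t≉0 | _ with t⁻¹ , t⁻¹*t≈1 ← inverse t≉0 = inj₂ (eigenvector≈0 (- p) u v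
    (trans (inverseʳ-unique (p * u) (γ * v) (begin
        p * u + γ * v
          ≈⟨ +-congˡ (*-congˡ (trans (*-congʳ t⁻¹*t≈1) (*-identityˡ v))) ⟨
        p * u + γ * (t⁻¹ * t * v)
          ≈⟨ solve 6 (λ γ s t t⁻¹ u v →
               t⁻¹ :* s :* u :+ γ :* (t⁻¹ :* t :* v) := t⁻¹ :* (s :* u :+ γ :* (t :* v)))
               refl γ s t t⁻¹ u v ⟩
        t⁻¹ * (s * u + γ * (t * v))
          ≈⟨ *-congˡ e₁ ⟩
        t⁻¹ * 0#
          ≈⟨ zeroʳ t⁻¹ ⟩
        0# ∎)) (-‿distribˡ-* p u))
    (trans (inverseʳ-unique (p * v) (u + β * v) (begin
        p * v + (u + β * v)
          ≈⟨ +-congˡ (+-cong (trans (*-congʳ t⁻¹*t≈1) (*-identityˡ u))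
               (*-congˡ (trans (*-congʳ t⁻¹*t≈1) (*-identityˡ v)))) ⟨
        p * v + (t⁻¹ * t * u + β * (t⁻¹ * t * v))
          ≈⟨ solve 6 (λ β s t t⁻¹ u v →
               t⁻¹ :* s :* v :+ (t⁻¹ :* t :* u :+ β :* (t⁻¹ :* t :* v)) :=
               t⁻¹ :* (s :* v :+ t :* u :+ β :* (t :* v)))
               refl β s t t⁻¹ u v ⟩
        t⁻¹ * (s * v + t * u + β * (t * v))
          ≈⟨ *-congˡ e₂ ⟩
        t⁻¹ * 0#
          ≈⟨ zeroʳ t⁻¹ ⟩
        0# ∎)) (-‿distribˡ-* p v)))
    where
    open SetoidReasoning setoid
    open Solver commutativeSemiring using (solve; _:=_; _:+_; _:*_; con)
    p = t⁻¹ * s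

  x : K.Carrier
  x = 0# , 1#

  ι : Carrier → K.Carrier
  ι e = e , 0#

  ι-* : ∀ d e → ι d K.* ι e K.≈ ι (d * e)
  ι-* d e =
    solve 4 (λ β γ d e → d :* e :+ γ :* (con 0 :* con 0) := d :* e) refl β γ d e ,
    solve 4 (λ β γ d e → d :* con 0 :+ con 0 :* e :+ β :* (con 0 :* con 0) := con 0) refl β γ d e
    where open Solver commutativeSemiring using (solve; _:=_; _:+_; _:*_; con)

  ι-mono : IsRingMonomorphism rawRing K.rawRing ι
  ι-mono = record
    { isRingHomomorphism = record
      { isSemiringHomomorphism = record
        { isNearSemiringHomomorphism = record
          { +-isMonoidHomomorphism = record
            { isMagmaHomomorphism = record
              { isRelHomomorphism = record { cong = λ eq → eq , refl }
              ; homo = λ d e → refl , sym (+-identityʳ 0#)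
              }
            ; ε-homo = K.refl
            }
          ; *-homo = λ d e → K.sym (ι-* d e)
          }
        ; 1#-homo = K.refl
        }
      ; -‿homo = λ e → refl , sym ε⁻¹≈ε
      }
    ; injective = proj₁
    }

  -- Multiplication by `x` sends (u , v) to (γ v , u + β v), which is the Lucas recurrence in the
  -- second coordinate. Exponents start at 1 because the first coordinate involves the preceding
  -- Lucas number.
  x^[1+n] : ∀ n → x KE.^ suc n K.≈ (γ * U b c n , U b c (suc n))
  x^[1+n] zero = K.trans (K.*-identityʳ x) (sym (zeroʳ γ) , refl)
  x^[1+n] (suc n) = K.trans (K.*-congˡ {x} (x^[1+n] n))
    ( solve 3 (λ γ u v → con 0 :* (γ :* u) :+ γ :* (con 1 :* v) := γ :* v) refl γ (U b c n) (U b c (suc n))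
    , trans
        (solve 4 (λ β γ u v →
          con 0 :* v :+ con 1 :* (γ :* u) :+ β :* (con 1 :* v) := β :* v :+ γ :* u)
          refl β γ (U b c n) (U b c (suc n)))
        (+-congˡ (sym (-‿distribˡ-* c (U b c n)))))
    where open Solver commutativeSemiring using (solve; _:=_; _:+_; _:*_; con)

  x*x : x K.* x K.≈ ι β K.* x K.+ ι γ
  x*x =
    solve 2 (λ β γ → con 0 :* con 0 :+ γ :* (con 1 :* con 1) :=
      β :* con 0 :+ γ :* (con 0 :* con 1) :+ γ) refl β γ ,
    solve 2 (λ β γ → con 0 :* con 1 :+ con 1 :* con 0 :+ β :* (con 1 :* con 1) :=
      β :* con 1 :+ con 0 :* con 0 :+ β :* (con 0 :* con 1) :+ con 0) refl β γ
    where open Solver commutativeSemiring using (solve; _:=_; _:+_; _:*_; con)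

  x^q+x≈ιβ : x KE.^ q K.+ x K.≈ ι β
  x^q+x≈ιβ = ExtensionField.x^q+x≈β F card extension domain ι ι-mono
    {x} {β} {γ} x*x (λ e → 1≉0 ∘ proj₂)

  -- The second coordinate of x^q + x = β reads U_q + 1 = 0.
  U-q : U b c q ≈ - 1#
  U-q = inverseˡ-unique (U b c q) 1#
    (trans (+-congʳ (sym (proj₂ (x^[1+n] (suc m))))) (proj₂ x^q+x≈ιβ))

  -- The first coordinate of x^q + x = β reads γ U_(q-1) = β, and in the recurrence this cancels β
  -- U_q = -β.
  U-[1+q] : U b c (suc q) ≈ 0#
  U-[1+q] = begin
    β * U b c q - c * U b c (suc m)
      ≈⟨ +-cong (*-congˡ U-q) (-‿distribˡ-* c _) ⟩
    β * - 1# + γ * U b c (suc m)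
      ≈⟨ +-cong (sym (-‿distribʳ-* β 1#)) γU≈β ⟩
    - (β * 1#) + β
      ≈⟨ +-congʳ (-‿cong (*-identityʳ β)) ⟩
    - β + β
      ≈⟨ -‿inverseˡ β ⟩
    0# ∎
    where
    open SetoidReasoning setoid
    open RingProperties ring using (-‿distribʳ-*)
    γU≈β : γ * U b c (suc m) ≈ β
    γU≈β = trans (sym (proj₁ (x^[1+n] (suc m))))
      (trans (sym (+-identityʳ _)) (proj₁ x^q+x≈ιβ))

-- Coefficients of products of polynomials.

module Coefficients {a ℓ} (R : CommutativeRing a ℓ) where
  open CommutativeRing R hiding (zero)
  open Polynomial R
  open Lucas R
  open RawMagmaDefinitions (RawRing.*-rawMagma polyRawRing) using (_,_)
  open SetoidReasoning setoid
  open Solver commutativeSemiring using (solve; _:=_; _:+_; _:*_; con)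
  open GroupProperties +-group using (ε⁻¹≈ε; inverseʳ-unique; inverseˡ-unique; ∙-cancelʳ; ⁻¹-involutive)
  open RingProperties ring using (-‿distribˡ-*; -‿distribʳ-*; -1*x≈-x)

  coeff-+ₚ : ∀ p r n → coeff (p +ₚ r) n ≈ coeff p n + coeff r n
  coeff-+ₚ []      r       n       = sym (+-identityˡ _)
  coeff-+ₚ (x ∷ p) []      n       = sym (+-identityʳ _)
  coeff-+ₚ (x ∷ p) (y ∷ r) zero    = refl
  coeff-+ₚ (x ∷ p) (y ∷ r) (suc n) = coeff-+ₚ p r n

  coeff-map-* : ∀ x p n → coeff (map (x *_) p) n ≈ x * coeff p n
  coeff-map-* x []      n       = sym (zeroʳ x)
  coeff-map-* x (y ∷ p) zero    = refl
  coeff-map-* x (y ∷ p) (suc n) = coeff-map-* x p n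

  coeff--ₚ : ∀ p n → coeff (-ₚ p) n ≈ - coeff p n
  coeff--ₚ []      n       = sym ε⁻¹≈ε
  coeff--ₚ (x ∷ p) zero    = refl
  coeff--ₚ (x ∷ p) (suc n) = coeff--ₚ p n

  coeff-∷-*ₚ : ∀ x p r n → coeff ((x ∷ p) *ₚ r) n ≈ x * coeff r n + coeff (0# ∷ (p *ₚ r)) n
  coeff-∷-*ₚ x p r n = trans (coeff-+ₚ (map (x *_) r) (0# ∷ (p *ₚ r)) n) (+-congʳ (coeff-map-* x r n))

  coeff-∷-*ₚ-zero : ∀ x p r → coeff ((x ∷ p) *ₚ r) 0 ≈ x * coeff r 0
  coeff-∷-*ₚ-zero x p r = trans (coeff-∷-*ₚ x p r 0) (+-identityʳ _)

  coeff-*ₚ-[] : ∀ p n → coeff (p *ₚ []) n ≈ 0#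
  coeff-*ₚ-[] []      n       = refl
  coeff-*ₚ-[] (x ∷ p) zero    = refl
  coeff-*ₚ-[] (x ∷ p) (suc n) = coeff-*ₚ-[] p n

  *ₚ-congˡ : ∀ p {r r′} → r ≈ₚ r′ → p *ₚ r ≈ₚ p *ₚ r′
  *ₚ-congˡ []      r≈r′ n = refl
  *ₚ-congˡ (x ∷ p) {r} {r′} r≈r′ n =
    trans (coeff-∷-*ₚ x p r n) (trans (+-cong (*-congˡ (r≈r′ n)) (tail n)) (sym (coeff-∷-*ₚ x p r′ n)))
    where
    tail : ∀ n → coeff (0# ∷ (p *ₚ r)) n ≈ coeff (0# ∷ (p *ₚ r′)) n
    tail zero    = refl
    tail (suc n) = *ₚ-congˡ p r≈r′ n

  coeff-*ₚ-∷-zero : ∀ p x r → coeff (p *ₚ (x ∷ r)) 0 ≈ coeff p 0 * x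
  coeff-*ₚ-∷-zero []      x r = sym (zeroˡ x)
  coeff-*ₚ-∷-zero (y ∷ p) x r = coeff-∷-*ₚ-zero y p (x ∷ r)

  -- `_*ₚ_` recurses on its left factor, but in the applications that factor is arbitrary and the
  -- right one is an explicit short list. This is the expansion p (x + X r) = p x + X (p r) along
  -- the right factor.
  coeff-*ₚ-∷-suc : ∀ p x r n →
    coeff (p *ₚ (x ∷ r)) (suc n) ≈ coeff p (suc n) * x + coeff (p *ₚ r) n
  coeff-*ₚ-∷-suc []      x r n = sym (trans (+-identityʳ _) (zeroˡ x))
  coeff-*ₚ-∷-suc (y ∷ p) x r zero = begin
    coeff ((y ∷ p) *ₚ (x ∷ r)) 1               ≈⟨ coeff-∷-*ₚ y p (x ∷ r) 1 ⟩
    y * coeff r 0 + coeff (p *ₚ (x ∷ r)) 0     ≈⟨ +-comm _ _ ⟩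
    coeff (p *ₚ (x ∷ r)) 0 + y * coeff r 0
      ≈⟨ +-cong (coeff-*ₚ-∷-zero p x r) (sym (coeff-∷-*ₚ-zero y p r)) ⟩
    coeff p 0 * x + coeff ((y ∷ p) *ₚ r) 0     ∎
  coeff-*ₚ-∷-suc (y ∷ p) x r (suc n) = begin
    coeff ((y ∷ p) *ₚ (x ∷ r)) (2 ℕ.+ n)
      ≈⟨ coeff-∷-*ₚ y p (x ∷ r) (2 ℕ.+ n) ⟩
    y * coeff r (suc n) + coeff (p *ₚ (x ∷ r)) (suc n)
      ≈⟨ +-congˡ (coeff-*ₚ-∷-suc p x r n) ⟩
    y * coeff r (suc n) + (coeff p (suc n) * x + coeff (p *ₚ r) n)
      ≈⟨ solve 3 (λ s t u → s :+ (t :+ u) := t :+ (s :+ u)) refl _ _ _ ⟩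
    coeff p (suc n) * x + (y * coeff r (suc n) + coeff (p *ₚ r) n)
      ≈⟨ +-congˡ (coeff-∷-*ₚ y p r (suc n)) ⟨
    coeff p (suc n) * x + coeff ((y ∷ p) *ₚ r) (suc n) ∎

  coeff-C*ₚ : ∀ x p n → coeff (C x *ₚ p) n ≈ x * coeff p n
  coeff-C*ₚ x p n = trans (coeff-∷-*ₚ x [] p n) (trans (+-congˡ (0∷[] n)) (+-identityʳ _))
    where
    0∷[] : ∀ n → coeff (0# ∷ []) n ≈ 0#
    0∷[] zero    = refl
    0∷[] (suc n) = refl

  coeff-X*ₚ-zero : ∀ p → coeff (X *ₚ p) 0 ≈ 0#
  coeff-X*ₚ-zero p = trans (coeff-∷-*ₚ-zero 0# (1# ∷ []) p) (zeroˡ _)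

  coeff-X*ₚ-suc : ∀ p n → coeff (X *ₚ p) (suc n) ≈ coeff p n
  coeff-X*ₚ-suc p n = begin
    coeff (X *ₚ p) (suc n)                       ≈⟨ coeff-∷-*ₚ 0# (1# ∷ []) p (suc n) ⟩
    0# * coeff p (suc n) + coeff (C 1# *ₚ p) n   ≈⟨ +-cong (zeroˡ _) (coeff-C*ₚ 1# p n) ⟩
    0# + 1# * coeff p n                          ≈⟨ trans (+-identityˡ _) (*-identityˡ _) ⟩
    coeff p n                                    ∎

  quadratic≈ : ∀ b c → quadratic b c ≈ₚ c ∷ b ∷ 1# ∷ []
  quadratic≈ b c n = trans (coeff-+ₚ (X ^ 2 +ₚ C b *ₚ X) (C c) n)
    (trans (+-congʳ (trans (coeff-+ₚ (X ^ 2) (C b *ₚ X) n) (+-congˡ (coeff-C*ₚ b X n)))) (sum≈ n))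
    where
    sum≈ : ∀ n → coeff (X ^ 2) n + b * coeff X n + coeff (C c) n ≈ coeff (c ∷ b ∷ 1# ∷ []) n
    sum≈ 0 = trans (+-congʳ (trans (+-cong (coeff-X*ₚ-zero (X ^ 1)) (zeroʳ b)) (+-identityʳ 0#))) (+-identityˡ c)
    sum≈ 1 = trans (+-identityʳ _) (trans
      (+-cong (trans (coeff-X*ₚ-suc (X ^ 1) 0) (coeff-X*ₚ-zero (X ^ 0))) (*-identityʳ b)) (+-identityˡ b))
    sum≈ 2 = trans (+-identityʳ _) (trans
      (+-cong (trans (coeff-X*ₚ-suc (X ^ 1) 1) (coeff-X*ₚ-suc (X ^ 0) 0)) (zeroʳ b)) (+-identityʳ 1#))
    sum≈ (suc (suc (suc n))) = trans (+-identityʳ _) (trans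
      (+-cong (trans (coeff-X*ₚ-suc (X ^ 1) (suc (suc n))) (coeff-X*ₚ-suc (X ^ 0) (suc n))) (zeroʳ b))
      (+-identityʳ 0#))

  coeff-*ₚ-quadratic-0 : ∀ p b c → coeff (p *ₚ quadratic b c) 0 ≈ coeff p 0 * c
  coeff-*ₚ-quadratic-0 p b c = trans (*ₚ-congˡ p (quadratic≈ b c) 0) (coeff-*ₚ-∷-zero p c _)

  coeff-*ₚ-quadratic-1 : ∀ p b c → coeff (p *ₚ quadratic b c) 1 ≈ coeff p 1 * c + coeff p 0 * b
  coeff-*ₚ-quadratic-1 p b c = trans (*ₚ-congˡ p (quadratic≈ b c) 1)
    (trans (coeff-*ₚ-∷-suc p c _ 0) (+-congˡ (coeff-*ₚ-∷-zero p b _)))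

  coeff-*ₚ-quadratic : ∀ p b c n → coeff (p *ₚ quadratic b c) (2 ℕ.+ n) ≈
    coeff p n + coeff p (1 ℕ.+ n) * b + coeff p (2 ℕ.+ n) * c
  coeff-*ₚ-quadratic p b c n = begin
    coeff (p *ₚ quadratic b c) (2 ℕ.+ n)
      ≈⟨ *ₚ-congˡ p (quadratic≈ b c) (2 ℕ.+ n) ⟩
    coeff (p *ₚ (c ∷ b ∷ 1# ∷ [])) (2 ℕ.+ n)
      ≈⟨ trans (coeff-*ₚ-∷-suc p c _ (suc n)) (+-congˡ (coeff-*ₚ-∷-suc p b _ n)) ⟩
    p₂ * c + (p₁ * b + coeff (p *ₚ C 1#) n)
      ≈⟨ +-congˡ (+-congˡ (coeff-*ₚ-1 n)) ⟩
    p₂ * c + (p₁ * b + coeff p n)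
      ≈⟨ solve 3 (λ s t u → s :+ (t :+ u) := u :+ t :+ s) refl _ _ _ ⟩
    coeff p n + p₁ * b + p₂ * c ∎
    where
    p₁ = coeff p (1 ℕ.+ n)
    p₂ = coeff p (2 ℕ.+ n)
    coeff-*ₚ-1 : ∀ n → coeff (p *ₚ C 1#) n ≈ coeff p n
    coeff-*ₚ-1 zero    = trans (coeff-*ₚ-∷-zero p 1# []) (*-identityʳ _)
    coeff-*ₚ-1 (suc n) = trans (coeff-*ₚ-∷-suc p 1# [] n)
      (trans (+-cong (*-identityʳ _) (coeff-*ₚ-[] p n)) (+-identityʳ _))

  -- Linear factors and the absence of roots.

  coeff-*ₚ-linear : ∀ p d n → coeff (p *ₚ (d ∷ 1# ∷ [])) (suc n) ≈ coeff p (suc n) * d + coeff p n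
  coeff-*ₚ-linear p d zero    = trans (coeff-*ₚ-∷-suc p d _ 0)
    (+-congˡ (trans (coeff-*ₚ-∷-zero p 1# []) (*-identityʳ _)))
  coeff-*ₚ-linear p d (suc n) = trans (coeff-*ₚ-∷-suc p d _ (suc n))
    (+-congˡ (trans (coeff-*ₚ-∷-suc p 1# [] n)
      (trans (+-cong (*-identityʳ _) (coeff-*ₚ-[] p n)) (+-identityʳ _))))

  -- If p (d + X) = 1, the coefficients above the constant one give p_n = -d p_(n+1). The list `p`
  -- is finite, so its coefficients vanish from the top down, and the constant coefficient then
  -- reads 1 = 0.
  linear∤1 : ∀ d → (d ∷ 1# ∷ []) ∣ C 1# → 1# ≈ 0#
  linear∤1 d (p , eq) = begin
    1#                               ≈⟨ eq 0 ⟨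
    coeff (p *ₚ (d ∷ 1# ∷ [])) 0     ≈⟨ coeff-*ₚ-∷-zero p d _ ⟩
    coeff p 0 * d                    ≈⟨ *-congʳ (vanish p (λ n → trans (sym (coeff-*ₚ-linear p d n)) (eq (suc n))) 0) ⟩
    0# * d                           ≈⟨ zeroˡ d ⟩
    0#                               ∎
    where
    vanish : ∀ p → (∀ n → coeff p (suc n) * d + coeff p n ≈ 0#) → ∀ n → coeff p n ≈ 0#
    vanish []      rec n       = refl
    vanish (x ∷ p) rec (suc n) = vanish p (rec ∘ suc) n
    vanish (x ∷ p) rec zero    = begin
      x                    ≈⟨ +-identityˡ x ⟨
      0# + x               ≈⟨ +-congʳ (trans (*-congʳ (vanish p (rec ∘ suc) 0)) (zeroˡ d)) ⟨
      coeff p 0 * d + x    ≈⟨ rec 0 ⟩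
      0#                   ∎

  -- The two roots sum to -b, so the second one is -(b + r).
  root⇒factorisation : ∀ b c r → r * r ≈ (- b) * r - c →
    quadratic b c ≈ₚ (- r ∷ 1# ∷ []) *ₚ (b + r ∷ 1# ∷ [])
  root⇒factorisation b c r r² n =
    trans (quadratic≈ b c n) (sym (product≈ n))
    where
    product≈ : (- r ∷ 1# ∷ []) *ₚ (b + r ∷ 1# ∷ []) ≈ₚ c ∷ b ∷ 1# ∷ []
    product≈ 0 = begin
      coeff ((- r ∷ 1# ∷ []) *ₚ (b + r ∷ 1# ∷ [])) 0 ≈⟨ coeff-*ₚ-∷-zero (- r ∷ 1# ∷ []) (b + r) (1# ∷ []) ⟩
      - r * (b + r)            ≈⟨ -‿distribˡ-* r (b + r) ⟨
      - (r * (b + r))          ≈⟨ inverseˡ-unique c (r * (b + r)) c+r[b+r]≈0 ⟨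
      c                        ∎
      where
      c+r[b+r]≈0 : c + r * (b + r) ≈ 0#
      c+r[b+r]≈0 = begin
        c + r * (b + r)                    ≈⟨ +-congˡ (distribˡ r b r) ⟩
        c + (r * b + r * r)                ≈⟨ +-congˡ (+-cong (*-comm r b) (trans r² (+-congʳ (sym (-‿distribˡ-* b r))))) ⟩
        c + (b * r + (- (b * r) - c))      ≈⟨ solve 4 (λ c s t u → c :+ (s :+ (t :+ u)) := (s :+ t) :+ (c :+ u)) refl c (b * r) (- (b * r)) (- c) ⟩
        (b * r - b * r) + (c - c)          ≈⟨ +-cong (-‿inverseʳ _) (-‿inverseʳ c) ⟩
        0# + 0#                            ≈⟨ +-identityʳ 0# ⟩
        0#                                 ∎
    product≈ 1 = begin
      coeff ((- r ∷ 1# ∷ []) *ₚ (b + r ∷ 1# ∷ [])) 1 ≈⟨ coeff-*ₚ-linear (- r ∷ 1# ∷ []) (b + r) 0 ⟩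
      1# * (b + r) - r         ≈⟨ +-congʳ (*-identityˡ _) ⟩
      b + r - r                ≈⟨ +-assoc b r (- r) ⟩
      b + (r - r)              ≈⟨ +-congˡ (-‿inverseʳ r) ⟩
      b + 0#                   ≈⟨ +-identityʳ b ⟩
      b                        ∎
    product≈ 2 = trans (coeff-*ₚ-linear (- r ∷ 1# ∷ []) (b + r) 1)
      (trans (+-congʳ (zeroˡ _)) (+-identityˡ 1#))
    product≈ (suc (suc (suc n))) = trans (coeff-*ₚ-linear (- r ∷ 1# ∷ []) (b + r) (2 ℕ.+ n))
      (trans (+-congʳ (zeroˡ _)) (+-identityˡ 0#))

  irreducible⇒no-root : ¬ 1# ≈ 0# → ∀ b c → Irreducible (quadratic b c) →
                        NoRoot R b c
  irreducible⇒no-root 1≉0 b c irr r r² =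
    [ 1≉0 ∘ linear∤1 (- r) , 1≉0 ∘ linear∤1 (b + r) ]′
      (split-∣1 irr {x = - r ∷ 1# ∷ []} {b + r ∷ 1# ∷ []} (root⇒factorisation b c r r²))
    where open Irreducible

  -- Descending sums as coefficient lists.

  -- descending recurses on its leading coefficient; the Lucas recurrence has to be
  -- read off by recursion from the constant term.
  descendingList : ℕ → (ℕ → Carrier) → Poly
  descendingList zero    h = h 1 ∷ []
  descendingList (suc m) h = h (2 ℕ.+ m) ∷ descendingList m h

  -- Removing the leading term shifts `h`, whereas removing the constant term shortens the list. The
  -- two are reconciled by stripping one power of X at a time until the leading term is reached.
  leading+rest : ∀ m h n →
    h 1 * coeff (X ^ suc m) n + coeff (descendingList m (h ∘ suc)) n ≈
    coeff (descendingList (suc m) h) n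
  leading+rest zero h zero =
    trans (+-congʳ (trans (*-congˡ (coeff-X*ₚ-zero (X ^ 0))) (zeroʳ _))) (+-identityˡ _)
  leading+rest (suc m) h zero =
    trans (+-congʳ (trans (*-congˡ (coeff-X*ₚ-zero (X ^ suc m))) (zeroʳ _))) (+-identityˡ _)
  leading+rest zero h (suc zero) = trans (+-identityʳ _)
    (trans (*-congˡ (coeff-X*ₚ-suc (X ^ 0) 0)) (*-identityʳ _))
  leading+rest zero h (suc (suc n)) = trans (+-identityʳ _)
    (trans (*-congˡ (coeff-X*ₚ-suc (X ^ 0) (suc n))) (zeroʳ _))
  leading+rest (suc m) h (suc n) =
    trans (+-congʳ (*-congˡ (coeff-X*ₚ-suc (X ^ suc m) n))) (leading+rest m h n)

  descending≈ : ∀ m h → descending m h ≈ₚ descendingList m h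
  descending≈ zero h n = begin
    coeff (C (h 1) *ₚ X ^ 0 +ₚ []) n       ≈⟨ coeff-+ₚ (C (h 1) *ₚ X ^ 0) [] n ⟩
    coeff (C (h 1) *ₚ X ^ 0) n + 0#        ≈⟨ +-identityʳ _ ⟩
    coeff (C (h 1) *ₚ X ^ 0) n             ≈⟨ coeff-C*ₚ (h 1) (X ^ 0) n ⟩
    h 1 * coeff (C 1#) n                   ≈⟨ scale n ⟩
    coeff (C (h 1)) n                      ∎
    where
    scale : ∀ n → h 1 * coeff (C 1#) n ≈ coeff (C (h 1)) n
    scale zero    = *-identityʳ _
    scale (suc n) = zeroʳ _
  descending≈ (suc m) h n = begin
    coeff (descending (suc m) h) n
      ≈⟨ coeff-+ₚ (C (h 1) *ₚ X ^ suc m) (descending m (h ∘ suc)) n ⟩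
    coeff (C (h 1) *ₚ X ^ suc m) n + coeff (descending m (h ∘ suc)) n
      ≈⟨ +-cong (coeff-C*ₚ (h 1) (X ^ suc m) n) (descending≈ m (h ∘ suc) n) ⟩
    h 1 * coeff (X ^ suc m) n + coeff (descendingList m (h ∘ suc)) n
      ≈⟨ leading+rest m h n ⟩
    coeff (descendingList (suc m) h) n ∎

  coeff-descending*quadratic : ∀ m h b c n →
    coeff (descending m h *ₚ quadratic b c) (2 ℕ.+ n) ≈
    coeff (descendingList m h) n + coeff (descendingList m h) (1 ℕ.+ n) * b
      + coeff (descendingList m h) (2 ℕ.+ n) * c
  coeff-descending*quadratic m h b c n = trans (coeff-*ₚ-quadratic (descending m h) b c n)
    (+-cong (+-cong (descending≈ m h n) (*-congʳ (descending≈ m h (1 ℕ.+ n))))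
      (*-congʳ (descending≈ m h (2 ℕ.+ n))))

  -- The product with the quadratic and the Lucas recurrence.

  module _ (b c : Carrier) where

    U-recurrence : ∀ n → U b c (2 ℕ.+ n) + (U b c (1 ℕ.+ n) * b + U b c n * c) ≈ 0#
    U-recurrence n = begin
      - b * U b c (1 ℕ.+ n) - c * U b c n + (U b c (1 ℕ.+ n) * b + U b c n * c)
        ≈⟨ +-cong (+-congʳ (sym (-‿distribˡ-* b _))) (+-cong (*-comm _ b) (*-comm _ c)) ⟩
      - s - t + (s + t)
        ≈⟨ solve 4 (λ s t s′ t′ → s′ :+ t′ :+ (s :+ t) := (s :+ s′) :+ (t :+ t′)) refl s t (- s) (- t) ⟩
      (s - s) + (t - t)
        ≈⟨ +-cong (-‿inverseʳ s) (-‿inverseʳ t) ⟩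
      0# + 0#
        ≈⟨ +-identityʳ 0# ⟩
      0# ∎
      where
      s = b * U b c (1 ℕ.+ n)
      t = c * U b c n

    -- the coefficient of X^(n+2) in (h₁ X^m + ⋯ + hₘ₊₁) f
    recurrence : ℕ → (ℕ → Carrier) → ℕ → Carrier
    recurrence m h n = coeff (descendingList m h) n + coeff (descendingList m h) (1 ℕ.+ n) * b
      + coeff (descendingList m h) (2 ℕ.+ n) * c

    -- For `m` zero the list has a single entry, and the default coefficient 0 agrees with U_0 = 0.
    coeff-descendingList-U-1 : ∀ m → coeff (descendingList m (U b c)) 1 ≈ U b c m
    coeff-descendingList-U-1 zero          = refl
    coeff-descendingList-U-1 (suc zero)    = refl
    coeff-descendingList-U-1 (suc (suc m)) = refl

    coeff-descendingList-0 : ∀ m h → coeff (descendingList m h) 0 ≈ h (suc m)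
    coeff-descendingList-0 zero    h = refl
    coeff-descendingList-0 (suc m) h = refl

    recurrence-zero : ∀ h n → recurrence 0 h n ≈ coeff (C (h 1)) n
    recurrence-zero h n =
      solve 3 (λ e b c → e :+ con 0 :* b :+ con 0 :* c := e) refl (coeff (C (h 1)) n) b c

    -- Below the leading coefficient U_1 = 1 everything cancels by the Lucas recurrence. Dropping
    -- the constant term turns `recurrence (suc m) h (suc n)` into `recurrence m h n` with the same
    -- `h`, so only n = 0 is new at each stage.
    recurrence-U : ∀ m n → recurrence m (U b c) n ≈ coeff (X ^ m) n
    recurrence-U zero zero    = recurrence-zero (U b c) 0
    recurrence-U zero (suc n) = recurrence-zero (U b c) (suc n)
    recurrence-U (suc m) zero = begin
      U b c (2 ℕ.+ m) + coeff (descendingList m (U b c)) 0 * b + coeff (descendingList m (U b c)) 1 * c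
        ≈⟨ +-cong (+-congˡ (*-congʳ (coeff-descendingList-0 m (U b c)))) (*-congʳ (coeff-descendingList-U-1 m)) ⟩
      U b c (2 ℕ.+ m) + U b c (1 ℕ.+ m) * b + U b c m * c
        ≈⟨ +-assoc _ _ _ ⟩
      U b c (2 ℕ.+ m) + (U b c (1 ℕ.+ m) * b + U b c m * c)
        ≈⟨ U-recurrence m ⟩
      0#
        ≈⟨ coeff-X*ₚ-zero (X ^ m) ⟨
      coeff (X ^ suc m) 0 ∎
    recurrence-U (suc m) (suc n) = trans (recurrence-U m n) (sym (coeff-X*ₚ-suc (X ^ m) n))

    -- The equations for `suc m` with positive `n` are those for `m`, which fix all values but the
    -- last. The equation at n = 0 then determines the last value from the two before it.
    recurrence-unique : ∀ m h → (∀ n → recurrence m h n ≈ coeff (X ^ m) n) →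
                        ∀ i → i ℕ.≤ m → h (suc i) ≈ U b c (suc i)
    recurrence-unique zero h rec zero _ =
      trans (sym (recurrence-zero h 0)) (rec 0)
    recurrence-unique (suc m) h rec i i≤1+m = [ below , (λ { ≡.refl → top }) ]′ (ℕ.m≤n⇒m<n∨m≡n i≤1+m)
      where
      rec′ : ∀ n → recurrence m h n ≈ coeff (X ^ m) n
      rec′ n = trans (rec (suc n)) (coeff-X*ₚ-suc (X ^ m) n)
      below : suc i ℕ.≤ suc m → h (suc i) ≈ U b c (suc i)
      below (ℕ.s≤s i≤m) = recurrence-unique m h rec′ i i≤m
      h₀ : coeff (descendingList m h) 0 ≈ U b c (1 ℕ.+ m)
      h₀ = trans (coeff-descendingList-0 m h) (recurrence-unique m h rec′ m ℕ.≤-refl)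
      h₁ : coeff (descendingList m h) 1 ≈ U b c m
      -- When `m` is zero, `h 0` is unconstrained; the missing second entry contributes the default
      -- 0, which is U_0.
      h₁ = go m ≡.refl
        where
        go : ∀ k → k ≡ m → coeff (descendingList k h) 1 ≈ U b c k
        go zero    _      = refl
        go (suc k) ≡.refl = trans (coeff-descendingList-0 k h)
          (recurrence-unique m h rec′ k (ℕ.n≤1+n k))
      top : h (2 ℕ.+ m) ≈ U b c (2 ℕ.+ m)
      top = ∙-cancelʳ (U b c (1 ℕ.+ m) * b + U b c m * c) _ _ (begin
        h (2 ℕ.+ m) + (U b c (1 ℕ.+ m) * b + U b c m * c)
          ≈⟨ +-assoc _ _ _ ⟨
        h (2 ℕ.+ m) + U b c (1 ℕ.+ m) * b + U b c m * c
          ≈⟨ +-cong (+-congˡ (*-congʳ h₀)) (*-congʳ h₁) ⟨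
        recurrence (suc m) h 0
          ≈⟨ rec 0 ⟩
        coeff (X ^ suc m) 0
          ≈⟨ coeff-X*ₚ-zero (X ^ m) ⟩
        0#
          ≈⟨ U-recurrence m ⟨
        U b c (2 ℕ.+ m) + (U b c (1 ℕ.+ m) * b + U b c m * c) ∎)

    -- The recurrence cancels every coefficient strictly between the leading one and that of X; the
    -- two lowest survive because the sum stops at U_(m+1). Taking m = q gives the quotient, and m =
    -- q - 1 the divisibility of X^(q+1) - c.
    descending-U*quadratic : ∀ m → descending m (U b c) *ₚ quadratic b c ≈ₚ
      X ^ (2 ℕ.+ m) +ₚ (U b c (1 ℕ.+ m) * c ∷ - U b c (2 ℕ.+ m) ∷ [])
    descending-U*quadratic m n =
      trans (lhs n) (sym (coeff-+ₚ (X ^ (2 ℕ.+ m)) (U b c (1 ℕ.+ m) * c ∷ - U b c (2 ℕ.+ m) ∷ []) n))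
      where
      D₀ : coeff (descending m (U b c)) 0 ≈ U b c (1 ℕ.+ m)
      D₀ = trans (descending≈ m (U b c) 0) (coeff-descendingList-0 m (U b c))
      D₁ : coeff (descending m (U b c)) 1 ≈ U b c m
      D₁ = trans (descending≈ m (U b c) 1) (coeff-descendingList-U-1 m)
      lhs : ∀ n → coeff (descending m (U b c) *ₚ quadratic b c) n ≈
        coeff (X ^ (2 ℕ.+ m)) n + coeff (U b c (1 ℕ.+ m) * c ∷ - U b c (2 ℕ.+ m) ∷ []) n
      lhs 0 = begin
        coeff (descending m (U b c) *ₚ quadratic b c) 0 ≈⟨ coeff-*ₚ-quadratic-0 (descending m (U b c)) b c ⟩
        coeff (descending m (U b c)) 0 * c   ≈⟨ *-congʳ D₀ ⟩
        U b c (1 ℕ.+ m) * c                  ≈⟨ +-identityˡ _ ⟨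
        0# + U b c (1 ℕ.+ m) * c             ≈⟨ +-congʳ (coeff-X*ₚ-zero (X ^ suc m)) ⟨
        coeff (X ^ (2 ℕ.+ m)) 0 + U b c (1 ℕ.+ m) * c ∎
      lhs 1 = begin
        coeff (descending m (U b c) *ₚ quadratic b c) 1
          ≈⟨ coeff-*ₚ-quadratic-1 (descending m (U b c)) b c ⟩
        coeff (descending m (U b c)) 1 * c + coeff (descending m (U b c)) 0 * b
          ≈⟨ +-cong (*-congʳ D₁) (*-congʳ D₀) ⟩
        U b c m * c + U b c (1 ℕ.+ m) * b
          ≈⟨ +-comm _ _ ⟩
        U b c (1 ℕ.+ m) * b + U b c m * c
          ≈⟨ inverseʳ-unique _ _ (U-recurrence m) ⟩
        - U b c (2 ℕ.+ m)
          ≈⟨ +-identityˡ _ ⟨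
        0# - U b c (2 ℕ.+ m)
          ≈⟨ +-congʳ (trans (coeff-X*ₚ-suc (X ^ suc m) 0) (coeff-X*ₚ-zero (X ^ m))) ⟨
        coeff (X ^ (2 ℕ.+ m)) 1 - U b c (2 ℕ.+ m) ∎
      lhs (suc (suc n)) = begin
        coeff (descending m (U b c) *ₚ quadratic b c) (2 ℕ.+ n)
          ≈⟨ coeff-descending*quadratic m (U b c) b c n ⟩
        recurrence m (U b c) n             ≈⟨ recurrence-U m n ⟩
        coeff (X ^ m) n                    ≈⟨ coeff-X*ₚ-suc (X ^ m) n ⟨
        coeff (X ^ suc m) (suc n)          ≈⟨ coeff-X*ₚ-suc (X ^ suc m) (suc n) ⟨
        coeff (X ^ (2 ℕ.+ m)) (2 ℕ.+ n)    ≈⟨ +-identityʳ _ ⟨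
        coeff (X ^ (2 ℕ.+ m)) (2 ℕ.+ n) + 0# ∎

    coeff-X^-cX : ∀ m n → coeff (X ^ m -ₚ C c *ₚ X) n ≈ coeff (X ^ m) n - c * coeff X n
    coeff-X^-cX m n = trans (coeff-+ₚ (X ^ m) (-ₚ (C c *ₚ X)) n)
      (+-congˡ (trans (coeff--ₚ (C c *ₚ X) n) (-‿cong (coeff-C*ₚ c X n))))

    isQuotient-U : ∀ q → U b c q ≈ - 1# → U b c (1 ℕ.+ q) ≈ 0# → IsQuotient q b c (U b c)
    isQuotient-U q Uq U1+q rewrite ℕ.+-comm q 2 = λ n → begin
      coeff (descending q (U b c) *ₚ quadratic b c) n
        ≈⟨ descending-U*quadratic q n ⟩
      coeff (X ^ (2 ℕ.+ q) +ₚ (U b c (1 ℕ.+ q) * c ∷ - U b c (2 ℕ.+ q) ∷ [])) n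
        ≈⟨ coeff-+ₚ (X ^ (2 ℕ.+ q)) (U b c (1 ℕ.+ q) * c ∷ - U b c (2 ℕ.+ q) ∷ []) n ⟩
      coeff (X ^ (2 ℕ.+ q)) n + coeff (U b c (1 ℕ.+ q) * c ∷ - U b c (2 ℕ.+ q) ∷ []) n
        ≈⟨ +-congˡ (remainder n) ⟩
      coeff (X ^ (2 ℕ.+ q)) n - c * coeff X n
        ≈⟨ coeff-X^-cX (2 ℕ.+ q) n ⟨
      coeff (X ^ (2 ℕ.+ q) -ₚ C c *ₚ X) n ∎
      where
      -- The surviving coefficient of X is -U_(q+2), which has to be -c; one more step of the
      -- recurrence gives it.
      U2+q : U b c (2 ℕ.+ q) ≈ c
      U2+q = begin
        - b * U b c (1 ℕ.+ q) - c * U b c q  ≈⟨ +-cong (*-congˡ U1+q) (-‿cong (*-congˡ Uq)) ⟩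
        - b * 0# - c * - 1#                  ≈⟨ +-cong (zeroʳ (- b)) (-‿distribʳ-* c (- 1#)) ⟩
        0# + c * (- - 1#)                    ≈⟨ trans (+-identityˡ _) (*-congˡ (⁻¹-involutive 1#)) ⟩
        c * 1#                               ≈⟨ *-identityʳ c ⟩
        c                                    ∎
      remainder : ∀ n → coeff (U b c (1 ℕ.+ q) * c ∷ - U b c (2 ℕ.+ q) ∷ []) n ≈ - (c * coeff X n)
      remainder 0 = trans (trans (*-congʳ U1+q) (zeroˡ c)) (sym (trans (-‿cong (zeroʳ c)) ε⁻¹≈ε))
      remainder 1 = -‿cong (trans U2+q (sym (*-identityʳ c)))
      remainder (suc (suc n)) = sym (trans (-‿cong (zeroʳ c)) ε⁻¹≈ε)

    -- Here `q` is one less than the cardinality of F, so the hypotheses are the values found in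
    -- `U-q` and `U-[1+q]`. They turn the two surviving terms into -c and 0.
    quadratic∣X^[q+1]-c : ∀ q → U b c (1 ℕ.+ q) ≈ - 1# → U b c (2 ℕ.+ q) ≈ 0# →
                          quadratic b c ∣ (X ^ (1 ℕ.+ q ℕ.+ 1) -ₚ C c)
    quadratic∣X^[q+1]-c q U1+q U2+q rewrite ℕ.+-comm q 1 = descending q (U b c) , λ n → begin
      coeff (descending q (U b c) *ₚ quadratic b c) n
        ≈⟨ descending-U*quadratic q n ⟩
      coeff (X ^ (2 ℕ.+ q) +ₚ (U b c (1 ℕ.+ q) * c ∷ - U b c (2 ℕ.+ q) ∷ [])) n
        ≈⟨ coeff-+ₚ (X ^ (2 ℕ.+ q)) (U b c (1 ℕ.+ q) * c ∷ - U b c (2 ℕ.+ q) ∷ []) n ⟩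
      coeff (X ^ (2 ℕ.+ q)) n + coeff (U b c (1 ℕ.+ q) * c ∷ - U b c (2 ℕ.+ q) ∷ []) n
        ≈⟨ +-congˡ (remainder n) ⟩
      coeff (X ^ (2 ℕ.+ q)) n + coeff (-ₚ C c) n
        ≈⟨ coeff-+ₚ (X ^ (2 ℕ.+ q)) (-ₚ C c) n ⟨
      coeff (X ^ (2 ℕ.+ q) -ₚ C c) n ∎
      where
      remainder : ∀ n → coeff (U b c (1 ℕ.+ q) * c ∷ - U b c (2 ℕ.+ q) ∷ []) n ≈ coeff (-ₚ C c) n
      remainder 0 = trans (*-congʳ U1+q) (-1*x≈-x c)
      remainder 1 = trans (-‿cong U2+q) ε⁻¹≈ε
      remainder (suc (suc n)) = refl

    -- Comparing coefficients from X² upwards, where -c X contributes nothing, gives the q + 1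
    -- equations that determine h_1, ..., h_(q+1).
    isQuotient⇒≈U : ∀ q h → IsQuotient q b c h → ∀ i → 1 ℕ.≤ i → i ℕ.≤ q ℕ.+ 1 → h i ≈ U b c i
    isQuotient⇒≈U q h quot (suc i) _ i≤q+1 rewrite ℕ.+-comm q 1 | ℕ.+-comm q 2 =
      recurrence-unique q h rec i (ℕ.s≤s⁻¹ i≤q+1)
      where
      rec : ∀ n → recurrence q h n ≈ coeff (X ^ q) n
      rec n = begin
        recurrence q h n
          ≈⟨ coeff-descending*quadratic q h b c n ⟨
        coeff (descending q h *ₚ quadratic b c) (2 ℕ.+ n)
          ≈⟨ quot (2 ℕ.+ n) ⟩
        coeff (X ^ (2 ℕ.+ q) -ₚ C c *ₚ X) (2 ℕ.+ n)
          ≈⟨ coeff-X^-cX (2 ℕ.+ q) (2 ℕ.+ n) ⟩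
        coeff (X ^ (2 ℕ.+ q)) (2 ℕ.+ n) - c * 0#
          ≈⟨ +-congˡ (trans (-‿cong (zeroʳ c)) ε⁻¹≈ε) ⟩
        coeff (X ^ (2 ℕ.+ q)) (2 ℕ.+ n) + 0#
          ≈⟨ +-identityʳ _ ⟩
        coeff (X ^ (2 ℕ.+ q)) (2 ℕ.+ n)
          ≈⟨ trans (coeff-X*ₚ-suc (X ^ suc q) (suc n)) (coeff-X*ₚ-suc (X ^ q) n) ⟩
        coeff (X ^ q) n ∎

open import Data.Nat.Base using (_+_; _≤_)

lemma6p2 : ∀ {a ℓ₁ ℓ₂} (F : HeytingField a ℓ₁ ℓ₂) (q : ℕ) →
  IsPrimePower q → HasCardinality F q →
  let open HeytingField F using (Carrier)
      open HeytingField F using (_≈_)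
      open Polynomial (ringOf F)
      open Lucas (ringOf F)
  in (b c : Carrier) → Irreducible (quadratic b c) →
     (quadratic b c ∣ (X ^ (q + 1) -ₚ C c))
     × (∃ λ (h : ℕ → Carrier) → IsQuotient q b c h)
     × (∀ (h : ℕ → Carrier) → IsQuotient q b c h →
          ∀ i → 1 ≤ i → i ≤ q + 1 → h i ≈ U b c i)
-- A field contains the distinct elements 0 and 1, so q has the form 2 + m.
lemma6p2 F zero _ card b c _ with () ← FiniteField.index F card b
lemma6p2 F (suc zero) _ card b c _ = ⊥-elim (1≉0 (index-injective (unique (index 1#) (index 0#))))
  where
  open HeytingField F using (1#; 0#)
  open FiniteField F card using (index; index-injective; 1≉0)
  unique : (i j : Fin 1) → i ≡ j
  unique zero zero = ≡.refl
lemma6p2 F (suc (suc m)) _ card b c irr =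
  quadratic∣X^[q+1]-c b c (suc m) U-q U-[1+q] ,
  (U b c , isQuotient-U b c (2 + m) U-q U-[1+q]) ,
  isQuotient⇒≈U b c (2 + m)
  where
  open Lucas (ringOf F)
  open Coefficients (ringOf F)
  open LucasPeriod F card b c
    (irreducible⇒no-root (FiniteField.1≉0 F card) b c irr)
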